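{- Let $G$ be a planar dual-critical graph. Then the planar dual of $G$ is factor-critical, for every planar embedding of $G$.
   Context: Graphs are finite, undirected, with non-empty vertex set; parallel edges and loops are allowed. An orientation of a graph is acyclic if it has no directed cycle (a directed loop counts as a directed cycle). A graph is dual-critical if it has an acyclic orientation in which all vertices except exactly one have odd indegree. A graph is factor-critical if for every vertex $v$ the graph $G-v$ has a perfect matching (the empty graph counts as having a perfect matching, so a single vertex is factor-critical). The planar dual with respect to a planar embedding has one vertex for each face and one edge for each edge $e$ of $G$, joining the faces on the two sides of $e$ (a loop if they coincide). -}

module Defs where

open import Data.Bool.Base using (Bool; true; false; not)
open import Data.Fin.Base using (Fin; zero; suc; toℕ)
open import Data.Fin.Properties using (_≟_; any?; nonZeroIndex)
open import Data.Fin.Subset using (Subset; _∈_; ⊤; _-_)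
open import Data.List.Base using (length; filter; allFin)
open import Data.Nat.Base using (ℕ; zero; suc; _+_; _*_; NonZero)
open import Data.Nat.Divisibility using (_∣_; _∤_)
open import Data.Nat.DivMod using (_mod_)
open import Data.Nat.GeneralisedArithmetic using (fold)
open import Data.Product.Base using (∃-syntax; _×_; _,_)
open import Data.Product using (∃!)
open import Data.Sum.Base using (_⊎_; inj₁; inj₂)
open import Function.Base using (_∘_)
open import Function.Bundles using (_↔_; _⇔_; module Inverse)
open import Function.Definitions using (Injective; StrictlySurjective)
open import Relation.Binary.Core using (Rel)
open import Relation.Binary.Construct.Closure.ReflexiveTransitive using (Star)
open import Relation.Binary.PropositionalEquality.Core using (_≡_; _≢_)
open import Relation.Nullary.Decidable.Core using (yes; no; _⊎-dec_)
open import Relation.Nullary.Negation.Core using (¬_)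

-- Undirected multigraphs with loops.  The two ends of an edge are labelled by
-- Bool only in order to name them; the labelling is not an orientation.
record Graph : Set where
  field
    vertices       : ℕ
    edges          : ℕ
    .{{nonEmpty}}  : NonZero vertices
    end            : Fin edges → Bool → Fin vertices

  Vertex : Set
  Vertex = Fin vertices

  Edge : Set
  Edge = Fin edges

  Incident : Edge → Vertex → Set
  Incident e v = ∃[ b ] end e b ≡ v

  Adjacent : Rel Vertex _
  Adjacent u v = ∃[ e ] ∃[ b ] (end e b ≡ u × end e (not b) ≡ v)

  Connected : Rel Vertex _
  Connected = Star Adjacent

  Dart : Set
  Dart = Edge × Bool

  base : Dart → Vertex
  base (e , b) = end e b

  opposite : Dart → Dart
  opposite (e , b) = e , not b

  Isolated : Vertex → Set
  Isolated v = ¬ (∃[ d ] base d ≡ v)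

-- An orientation chooses, for each edge, which of its two ends is the head.
module _ (G : Graph) where
  open Graph G

  Orientation : Set
  Orientation = Edge → Bool

  module _ (o : Orientation) where

    head : Edge → Vertex
    head e = end e (o e)

    tail : Edge → Vertex
    tail e = end e (not (o e))

    indegree : Vertex → ℕ
    indegree v = length (filter (λ e → head e ≟ v) (allFin edges))

    -- The edges arc 0, …, arc k, in cyclic order, of a cycle on k + 1
    -- distinct vertices; k = 0 is a loop.
    record DirectedCycle : Set where
      field
        k        : ℕ
        arc      : Fin (suc k) → Edge
        distinct : Injective _≡_ _≡_ (tail ∘ arc)
        closed   : ∀ i → head (arc i) ≡ tail (arc (suc (toℕ i) mod suc k))

    Acyclic : Set
    Acyclic = ¬ DirectedCycle

  DualCritical : Set
  DualCritical =
    ∃[ o ] (Acyclic o ×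
            ∃[ s ] (2 ∣ indegree o s × (∀ v → v ≢ s → 2 ∤ indegree o v)))

-- A perfect matching of the subgraph of G induced by S.
record PerfectMatching (G : Graph) (S : Subset (Graph.vertices G)) : Set where
  open Graph G
  field
    matching : Subset edges
    within   : ∀ {e} → e ∈ matching → ∀ b → end e b ∈ S
    loopless : ∀ {e} → e ∈ matching → end e false ≢ end e true
    covers   : ∀ {v} → v ∈ S → ∃! _≡_ (λ e → e ∈ matching × Incident e v)

FactorCritical : Graph → Set
FactorCritical G = ∀ v → PerfectMatching G (⊤ - v)

SameOrbit : {A : Set} → (A → A) → Rel A _
SameOrbit π x y = ∃[ k ] fold x π k ≡ y

-- The relation _~_ has exactly k classes, numbered by class.
record Classes {A : Set} (_~_ : Rel A _) (k : ℕ) : Set where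
  field
    class      : A → Fin k
    surjective : StrictlySurjective _≡_ class
    exact      : ∀ {x y} → class x ≡ class y ⇔ x ~ y

-- A planar embedding of a possibly disconnected graph in the (oriented) sphere,
-- up to homeomorphism.  The topology is recorded combinatorially:
--
--  * the clockwise order of the darts leaving each vertex;
--  * the boundary walks: the walk through a dart d keeps on its left the face
--    to the left of d, so at the far end it turns into the dart that is
--    clockwise next after the opposite of d.  An isolated vertex is a
--    boundary walk by itself;
--  * the distribution of the boundary walks among the faces.  A face has one
--    boundary walk for each component of the graph that it touches.
--
-- The surface obtained by gluing along each boundary walk the face it belongs
-- to (a sphere with holes) is the sphere iff every component has genus 0 and
-- the bipartite incidence graph of components and faces, with one link per
-- boundary walk, is a tree.  The fields euler, joined and tree say this: summed
-- over the components, V - E + W = 2 C - 2 (total genus), and a connected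
-- graph with C + F nodes and W links is a tree iff C + F = 1 + W.
module _ (G : Graph) where
  open Graph G

  data Corner : Set where
    dart     : Dart → Corner
    isolated : (v : Vertex) → .(Isolated v) → Corner

  at : Corner → Vertex
  at (dart d)       = base d
  at (isolated v _) = v

  next : (Dart → Dart) → Corner → Corner
  next clockwise (dart d)       = dart (clockwise (opposite d))
  next clockwise (isolated v i) = isolated v i

  record PlanarEmbedding : Set where
    field
      rotation   : Dart ↔ Dart

    clockwise : Dart → Dart
    clockwise = Inverse.to rotation

    field
      rotates    : ∀ {d d′} → SameOrbit clockwise d d′ ⇔ base d ≡ base d′
      components : ℕ
      component  : Classes Connected components
      walks      : ℕ
      walk       : Classes (SameOrbit (next clockwise)) walks
      faces      : ℕ
      faceOfWalk : Fin walks → Fin faces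
      surjective : StrictlySurjective _≡_ faceOfWalk

    face : Corner → Fin faces
    face = faceOfWalk ∘ Classes.class walk

    Cofacial : Rel Vertex _
    Cofacial u v = ∃[ x ] ∃[ y ] (at x ≡ u × at y ≡ v × face x ≡ face y)

    field
      euler      : vertices + walks ≡ edges + 2 * components
      joined     : ∀ u v → Star Cofacial u v
      tree       : components + faces ≡ 1 + walks

  cornerAt : Vertex → Corner
  cornerAt v with any? (λ e → (end e false ≟ v) ⊎-dec (end e true ≟ v))
  ... | yes (e , inj₁ _) = dart (e , false)
  ... | yes (e , inj₂ _) = dart (e , true)
  ... | no  none         = isolated v λ
    { ((e , false) , p) → none (e , inj₁ p)
    ; ((e , true)  , p) → none (e , inj₂ p)
    }

  someFace : (𝓔 : PlanarEmbedding) → Fin (PlanarEmbedding.faces 𝓔)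
  someFace 𝓔 = PlanarEmbedding.face 𝓔 (cornerAt (first vertices))
    where
    first : ∀ n → .{{NonZero n}} → Fin n
    first (suc _) = zero

  dual : PlanarEmbedding → Graph
  dual 𝓔 = record
    { vertices = faces
    ; edges    = edges
    ; nonEmpty = nonZeroIndex (someFace 𝓔)
    ; end      = λ e b → face (dart (e , b))
    }
    where open PlanarEmbedding 𝓔

-- Contract, in the dual, the edges directed to v, for the vertices v taken sinks
-- first.  When v is reached, all edges leaving it are contracted, so the edges
-- directed to v, in their rotation order, form a closed trail of length
-- d = indegree v in what is left of the dual.  Undoing the contractions one by
-- one, extend a set of edges that covers all nodes except possibly f: some node
-- of the restored trail is f or is covered already, and starting from it every
-- second edge of the trail, ⌊d/2⌋ edges in all, covers the other nodes of the
-- trail.  Since d is odd for v ≢ s, this gives m edges with 2m + V ≤ E + 1, and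
-- Euler's formula turns that into 2m ≤ F − 1.  So the 2m ends cover the F − 1
-- faces other than f without repetition, and the edges are a perfect matching.
-- It is this count that dispenses with the Jordan curve theorem: the closed
-- trails need not be shown to be cycles.

module Submission where

open import Data.Bool.Base using (Bool; true; false; not)
import Data.Bool.Properties as Bool
open import Data.Bool.Properties using (not-involutive; ¬-not)
open import Data.Fin.Base using (Fin; suc; toℕ)
open import Data.Fin.Properties
  using (_≟_; any?; all?; pigeonhole; toℕ-fromℕ<; toℕ-injective; toℕ<n; nonZeroIndex)
open import Data.Fin.Subset using (Subset; ⊤; _-_) renaming (_∈_ to _∈ˢ_)
open import Data.Fin.Subset.Properties using (∈⊤; x∈p∧x≢y⇒x∈p-y)
open import Data.List.Base
  using (List; []; _∷_; _++_; length; filter; map; concatMap; applyUpTo; allFin)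
open import Data.List.Properties
  using (length-++; length-++-comm; length-map; length-filter; length-tabulate;
         concatMap-++; map-concatMap; filter-notAll)
import Data.List.Membership.DecPropositional as DecMembership
open import Data.List.Membership.Propositional using (_∈_; _∉_; find; lose)
open import Data.List.Membership.Propositional.Properties
  using (∈-∃++; ∈-allFin; ∈-filter⁺; ∈-filter⁻; ∈-map⁺; ∈-map⁻; ∈-concatMap⁺; ∈-concatMap⁻;
         ∈-applyUpTo⁺; ∈-applyUpTo⁻; ∈-length)
open import Data.List.Relation.Binary.Subset.Propositional using (_⊆_)
import Data.List.Relation.Unary.All as All
open import Data.List.Relation.Unary.All using (All; []; _∷_)
open import Data.List.Relation.Unary.All.Properties using (¬Any⇒All¬)
open import Data.List.Relation.Unary.AllPairs using ([]; _∷_)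
import Data.List.Relation.Unary.Any as Any
open import Data.List.Relation.Unary.Any using (Any; here; there)
import Data.List.Relation.Unary.Any.Properties as Any
open import Data.List.Relation.Unary.Unique.Propositional using (Unique)
import Data.List.Relation.Unary.Unique.Propositional.Properties as Unique
open import Data.Maybe.Base using (Maybe; just; nothing)
import Data.Maybe.Properties as Maybe
open import Data.Nat.Base
open import Data.Nat.DivMod using (_%_; _/_; _mod_; m%n<n; m≡m%n+[m/n]*n)
open import Data.Nat.Divisibility using (_∤_; divides)
open import Data.Nat.GeneralisedArithmetic using (fold; fold-+)
open import Data.Nat.Properties hiding (_≟_)
open import Data.Nat.Tactic.RingSolver using (solve-∀)
open import Data.Product.Base using (∃-syntax; _×_; _,_; proj₁; proj₂)
open import Data.Product using (∃!)
import Data.Product.Properties as Product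
open import Data.Sum.Base using (_⊎_; inj₁; inj₂; map₂)
import Data.Vec.Base as Vec
open import Data.Vec.Base using (tabulate; _∷_; there)
open import Data.Vec.Properties using (lookup∘tabulate; []=⇒lookup; lookup⇒[]=)
open import Function.Base using (_∘_; id)
open import Function.Bundles using (module Equivalence)
open import Function.Definitions using (Injective)
open import Relation.Binary.Construct.Closure.ReflexiveTransitive using (Star; ε; _◅_)
open import Relation.Binary.Definitions using (DecidableEquality; tri<; tri≈; tri>)
open import Relation.Binary.PropositionalEquality
  using (_≡_; _≢_; refl; sym; trans; cong; subst; module ≡-Reasoning)
open import Relation.Nullary.Decidable
  using (Dec; yes; no; does; ¬?; _→-dec_; _×-dec_; decidable-stable; dec-true)
open import Relation.Nullary.Negation using (¬_; contradiction; contradiction-irr)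
open import Relation.Unary using (Decidable)

open import Defs

private
  variable
    A B : Set
    n   : ℕ

-- Periods of iterated maps.

least : {P : ℕ → Set} → Decidable P → ∀ {k} → P k →
        ∃[ m ] (P m × (∀ {i} → i < m → ¬ P i))
least P? {k} pk with P? 0
least P? {k}     pk | yes p0 = 0 , p0 , λ ()
least P? {zero}  pk | no ¬p0 = contradiction pk ¬p0
least P? {suc k} pk | no ¬p0
  with m , pm , below ← least (P? ∘ suc) pk
  = suc m , pm , λ { {zero} _ → ¬p0 ; {suc i} (s≤s i<m) → below i<m }

record Period (f : A → A) (a : A) : Set where
  field
    k         : ℕ -- one less than the period
    returns   : fold a f (suc k) ≡ a
    separates : ∀ {i j} → i < j → j < suc k → fold a f i ≢ fold a f j

  fold-* : ∀ m → fold a f (m * suc k) ≡ a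
  fold-* zero    = refl
  fold-* (suc m) = begin
    fold a f (suc k + m * suc k)          ≡⟨ fold-+ a f (suc k) ⟩
    fold (fold a f (m * suc k)) f (suc k) ≡⟨ cong (λ b → fold b f (suc k)) (fold-* m) ⟩
    fold a f (suc k)                      ≡⟨ returns ⟩
    a                                     ∎
    where open ≡-Reasoning

  fold-% : ∀ m → fold a f (m % suc k) ≡ fold a f m
  fold-% m = begin
    fold a f (m % suc k)
      ≡⟨ cong (λ b → fold b f (m % suc k)) (fold-* (m / suc k)) ⟨
    fold (fold a f (m / suc k * suc k)) f (m % suc k)
      ≡⟨ fold-+ a f (m % suc k) ⟨
    fold a f (m % suc k + m / suc k * suc k)
      ≡⟨ cong (fold a f) (m≡m%n+[m/n]*n m (suc k)) ⟨
    fold a f m ∎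
    where open ≡-Reasoning

  injective : Injective _≡_ _≡_ (λ (i : Fin (suc k)) → fold a f (toℕ i))
  injective {i} {j} eq with <-cmp (toℕ i) (toℕ j)
  ... | tri< i<j _ _ = contradiction eq (separates i<j (toℕ<n j))
  ... | tri≈ _ i≡j _ = toℕ-injective i≡j
  ... | tri> _ _ j<i = contradiction (sym eq) (separates j<i (toℕ<n i))

period : DecidableEquality A → (f : A → A) (a : A) →
         ∀ {k} → fold a f (suc k) ≡ a → Period f a
period _≟ᴬ_ f a {k₀} eq
  with k , returns , minimal ← least (λ k → fold a f (suc k) ≟ᴬ a) {k₀} eq
  = record { k = k ; returns = returns ; separates = separates }
  where
  separates : ∀ {i j} → i < j → j < suc k → fold a f i ≢ fold a f j
  -- If iterates `i < j` agree, `suc (k ∸ j)` further applications bring both to `a`, so `a` returns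
  -- after `suc (k ∸ j + i)` steps, sooner than the least return.
  separates {i} {j} i<j (s≤s j≤k) fᵢ≡fⱼ = minimal k∸j+i<k (begin
    fold a f (suc (k ∸ j) + i)          ≡⟨ fold-+ a f (suc (k ∸ j)) ⟩
    fold (fold a f i) f (suc (k ∸ j))   ≡⟨ cong (λ b → fold b f (suc (k ∸ j))) fᵢ≡fⱼ ⟩
    fold (fold a f j) f (suc (k ∸ j))   ≡⟨ fold-+ a f (suc (k ∸ j)) ⟨
    fold a f (suc (k ∸ j + j))          ≡⟨ cong (fold a f ∘ suc) (m∸n+n≡m j≤k) ⟩
    fold a f (suc k)                    ≡⟨ returns ⟩
    a                                   ∎)
    where
    open ≡-Reasoning
    k∸j+i<k : k ∸ j + i < k
    k∸j+i<k = subst (k ∸ j + i <_) (m∸n+n≡m j≤k) (+-monoʳ-< (k ∸ j) i<j)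

-- Two of the first `suc n` iterates agree by pigeonhole. As `f` need not be injective, the cycle
-- may be reached only after `i` steps.
eventuallyPeriodic : (f : Fin n → Fin n) (x : Fin n) → ∃[ i ] Period f (fold x f i)
eventuallyPeriodic {n} f x
  with i , j , i<j , fᵢ≡fⱼ ← pigeonhole (n<1+n n) (λ i → fold x f (toℕ i))
  = toℕ i , period _≟_ f _ {toℕ j ∸ suc (toℕ i)} (begin
    fold (fold x f (toℕ i)) f (suc (toℕ j ∸ suc (toℕ i)))
      ≡⟨ fold-+ x f (suc (toℕ j ∸ suc (toℕ i))) ⟨
    fold x f (suc (toℕ j ∸ suc (toℕ i)) + toℕ i)
      ≡⟨ cong (fold x f) (+-suc (toℕ j ∸ suc (toℕ i)) (toℕ i)) ⟨
    fold x f (toℕ j ∸ suc (toℕ i) + suc (toℕ i))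
      ≡⟨ cong (fold x f) (m∸n+n≡m i<j) ⟩
    fold x f (toℕ j)
      ≡⟨ fᵢ≡fⱼ ⟨
    fold x f (toℕ i) ∎)
  where open ≡-Reasoning

-- Counting in lists.

length-filter-map : {P : B → Set} (P? : Decidable P) (f : A → B) (xs : List A) →
                    length (filter P? (map f xs)) ≡ length (filter (P? ∘ f) xs)
length-filter-map P? f []       = refl
length-filter-map P? f (x ∷ xs) with does (P? (f x))
... | true  = cong suc (length-filter-map P? f xs)
... | false = length-filter-map P? f xs

module _ (_≟ᴬ_ : DecidableEquality A) where
  open DecMembership _≟ᴬ_ using (_∈?_; _∉?_)

  -- An entry equal to `y` passes the filter for `ys` but not the one for `y ∷ ys`. Applied to all
  -- vertices, this makes the search for sinks terminate; applied to the list of heads, it pays for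
  -- the matching edges.
  filter-∉-∷ : ∀ {y ys} → y ∉ ys → ∀ xs →
               length (filter (_≟ᴬ y) xs) + length (filter (_∉? (y ∷ ys)) xs) ≤
               length (filter (_∉? ys) xs)
  filter-∉-∷           y∉ys []       = z≤n
  filter-∉-∷ {y} {ys}  y∉ys (x ∷ xs) with ih ← filter-∉-∷ y∉ys xs | x ≟ᴬ y | x ∈? ys
  ... | yes refl | yes y∈ys = contradiction y∈ys y∉ys
  ... | yes refl | no  _    = s≤s ih
  ... | no  _    | yes _    = ih
  ... | no  _    | no  _    = ≤-trans (≤-reflexive (+-suc (length (filter (_≟ᴬ y) xs)) _)) (s≤s ih)

  unique-⊆⇒length≤ : ∀ {xs ys : List A} → Unique xs → xs ⊆ ys → length xs ≤ length ys
  unique-⊆⇒length≤ {[]}                _             _     = z≤n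
  unique-⊆⇒length≤ {x ∷ xs} {ys} (x∉xs ∷ xs!) xs⊆ys = ≤-<-trans
    (unique-⊆⇒length≤ xs! λ z∈xs →
      ∈-filter⁺ ≢x? (xs⊆ys (there z∈xs)) (All.lookup x∉xs z∈xs ∘ sym))
    (filter-notAll ≢x? ys (Any.map (λ { refl z≢z → z≢z refl }) (xs⊆ys (here refl))))
    where ≢x? = λ z → ¬? (z ≟ᴬ x)

  -- A repeated entry of `xs` could be dropped with `ys` still contained in the rest, which would
  -- then be shorter than the repetition-free `ys`.
  tight⇒unique : ∀ {xs ys : List A} → Unique ys → ys ⊆ xs → length xs ≤ length ys → Unique xs
  tight⇒unique {[]}                _   _     _         = []
  tight⇒unique {x ∷ xs} {ys} ys! ys⊆xs ∣xs∣≤∣ys∣ =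
    ¬Any⇒All¬ xs x∉xs ∷ tight⇒unique (Unique.filter⁺ ≢x? ys!) rest⊆xs ∣xs∣≤∣rest∣
    where
    ≢x?  = λ z → ¬? (z ≟ᴬ x)
    rest = filter ≢x? ys

    x∉xs : x ∉ xs
    x∉xs x∈xs = <⇒≱ ∣xs∣≤∣ys∣ (unique-⊆⇒length≤ ys! λ z∈ys →
      absorb x∈xs (ys⊆xs z∈ys))
      where
      absorb : ∀ {z} → x ∈ xs → z ∈ x ∷ xs → z ∈ xs
      absorb x∈xs (here refl) = x∈xs
      absorb _    (there z∈)  = z∈

    rest⊆xs : rest ⊆ xs
    rest⊆xs z∈rest with z∈ys , z≢x ← ∈-filter⁻ ≢x? z∈rest = Any.tail z≢x (ys⊆xs z∈ys)

    ∣xs∣≤∣rest∣ : length xs ≤ length rest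
    ∣xs∣≤∣rest∣ = s≤s⁻¹ (≤-trans ∣xs∣≤∣ys∣ (unique-⊆⇒length≤ ys! ys⊆x∷rest))
      where
      ys⊆x∷rest : ys ⊆ x ∷ rest
      ys⊆x∷rest {z} z∈ys with z ≟ᴬ x
      ... | yes z≡x = here z≡x
      ... | no  z≢x = there (∈-filter⁺ ≢x? z∈ys z≢x)

-- Closed trails and their contraction.

module Trails {D F : Set} (lo hi : D → F) where

  ends : List D → List F
  ends = concatMap (λ d → lo d ∷ hi d ∷ [])

  length-ends : ∀ ds → length (ends ds) ≡ 2 * length ds
  length-ends []       = refl
  length-ends (d ∷ ds) = begin
    2 + length (ends ds)  ≡⟨ cong (2 +_) (length-ends ds) ⟩
    2 + 2 * length ds     ≡⟨ *-suc 2 (length ds) ⟨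
    2 * suc (length ds)   ∎
    where open ≡-Reasoning

  everyOther : List D → List D
  everyOther []           = []
  everyOther (d ∷ [])     = []
  everyOther (d ∷ e ∷ ds) = e ∷ everyOther ds

  length-everyOther : ∀ ds → 2 * length (everyOther ds) ≤ length ds
  length-everyOther []           = z≤n
  length-everyOther (d ∷ [])     = z≤n
  length-everyOther (d ∷ e ∷ ds) = begin
    2 * suc (length (everyOther ds))  ≡⟨ *-suc 2 (length (everyOther ds)) ⟩
    2 + 2 * length (everyOther ds)    ≤⟨ +-monoʳ-≤ 2 (length-everyOther ds) ⟩
    2 + length ds                     ∎
    where open ≤-Reasoning

  module _ {A : Set} (_≟ᴬ_ : DecidableEquality A) (c : F → A) where

    infixr 5 _∷_

    -- The nodes of a contracted graph are the colours: the ends of a trail are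
    -- kept in F, but only their colours matter.
    data Trail (x : F) : List D → F → Set where
      stop : ∀ {y} → c x ≡ c y → Trail x [] y
      _∷_  : ∀ {d ds y} → c x ≡ c (lo d) → Trail (hi d) ds y → Trail x (d ∷ ds) y

    Covers : List F → F → Set
    Covers ys x = Any (λ y → c x ≡ c y) ys

    Touches : List D → F → Set
    Touches ds x = Any (λ d → c x ≡ c (lo d)) ds

    recolour : ∀ {x x′ ds y} → c x ≡ c x′ → Trail x′ ds y → Trail x ds y
    recolour eq (stop p) = stop (trans eq p)
    recolour eq (p ∷ t)  = trans eq p ∷ t

    trail-++⁺ : ∀ {x y z ds es} → Trail x ds y → Trail y es z → Trail x (ds ++ es) z
    trail-++⁺ (stop p) u = recolour p u
    trail-++⁺ (p ∷ t)  u = p ∷ trail-++⁺ t u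

    trail-++⁻ : ∀ {x z} ds {es} → Trail x (ds ++ es) z →
                ∃[ y ] (Trail x ds y × Trail y es z)
    trail-++⁻ []       t       = _ , stop refl , t
    trail-++⁻ (d ∷ ds) (p ∷ t) with y , t₁ , t₂ ← trail-++⁻ ds t = y , p ∷ t₁ , t₂

    -- A link that is left out joins two nodes of one colour, so it is a loop in the contracted
    -- graph and the trail closes up over it.
    trail-filter : ∀ {P : D → Set} (P? : Decidable P) {x y ds} →
                   (∀ {d} → d ∈ ds → ¬ P d → c (lo d) ≡ c (hi d)) →
                   Trail x ds y → Trail x (filter P? ds) y
    trail-filter P? skip (stop p) = stop p
    trail-filter P? skip (_∷_ {d} p t) with P? d
    ... | yes _  = p ∷ trail-filter P? (skip ∘ there) t
    ... | no ¬Pd = recolour (trans p (skip (here refl) ¬Pd)) (trail-filter P? (skip ∘ there) t)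

    -- The second, fourth, ... links are kept. Each of them covers its own start and the start of
    -- the link after it, while `x` covers the start of the first link.
    everyOther-covers : ∀ {x y ds} → Trail x ds y → ∀ {d} → d ∈ ds →
                        Covers (x ∷ ends (everyOther ds)) (lo d)
    everyOther-covers (p ∷ _)     (here refl)         = here (sym p)
    everyOther-covers (p ∷ q ∷ _) (there (here refl)) = there (here refl)
    -- The end of the kept link starts the remaining trail, so it takes over the role of `x`.
    everyOther-covers (p ∷ q ∷ t) (there (there d∈))  = there (there (everyOther-covers t d∈))

    closed-cover : ∀ {x ds} → Trail x ds x → ∀ {z} → Touches ds z →
                   ∃[ es ] (2 * length es ≤ length ds ×
                            (∀ {d} → d ∈ ds → Covers (z ∷ ends es) (lo d)))
    closed-cover t touch
      with d , d∈ds , z~d ← find touch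
      with xs , ys , refl ← ∈-∃++ d∈ds
      with _ , t₁ , p ∷ t₂ ← trail-++⁻ xs t
      -- the trail rotated so as to start at d
      = everyOther (d ∷ ys ++ xs) ,
        subst (2 * length (everyOther (d ∷ ys ++ xs)) ≤_)
              (length-++-comm (d ∷ ys) xs) (length-everyOther (d ∷ ys ++ xs)) ,
        λ e∈ → everyOther-covers (z~d ∷ trail-++⁺ t₂ t₁) (Any.++-comm xs (d ∷ ys) e∈)

    -- The end of a link has the colour of the next link's start, and the end of the last link that
    -- of the first link's start. Hence `Touches`, which looks at starts only, sees every node of a
    -- closed trail.
    hi-touched : ∀ {x ds} → Trail x ds x → ∀ {d} → d ∈ ds → Touches ds (hi d)
    hi-touched t@(p ∷ _) d∈ds with go t d∈ds
      where
      go : ∀ {x y ds} → Trail x ds y → ∀ {d} → d ∈ ds → c (hi d) ≡ c y ⊎ Touches ds (hi d)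
      go (_ ∷ stop q) (here refl) = inj₁ q
      go (_ ∷ q ∷ _)  (here refl) = inj₂ (there (here q))
      go (_ ∷ u)      (there d∈)  = map₂ there (go u d∈)
    ... | inj₁ eq    = here (trans eq p)
    ... | inj₂ touch = touch

    touches? : ∀ ds → Decidable (Touches ds)
    touches? ds x = Any.any? (λ d → c x ≟ᴬ c (lo d)) ds

    -- The colour nothing is the node that the trail is contracted to.
    contract : List D → F → Maybe A
    contract ds x with touches? ds x
    ... | yes _ = nothing
    ... | no  _ = just (c x)

    contract-touched : ∀ ds {x y} → Touches ds x → Touches ds y → contract ds x ≡ contract ds y
    contract-touched ds {x} {y} tx ty with touches? ds x | touches? ds y
    ... | yes _  | yes _  = refl
    ... | no ¬tx | _      = contradiction tx ¬tx
    ... | _      | no ¬ty = contradiction ty ¬ty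

    contract-cong : ∀ ds {x y} → c x ≡ c y → contract ds x ≡ contract ds y
    contract-cong ds {x} {y} eq with touches? ds x | touches? ds y
    ... | yes _  | yes _  = refl
    ... | no  _  | no  _  = cong just eq
    ... | yes tx | no ¬ty = contradiction (Any.map (trans (sym eq)) tx) ¬ty
    ... | no ¬tx | yes ty = contradiction (Any.map (trans eq) ty) ¬tx

    contract-injective : ∀ ds {x y} → ¬ Touches ds x → contract ds x ≡ contract ds y → c x ≡ c y
    contract-injective ds {x} {y} ¬tx eq with touches? ds x | touches? ds y
    contract-injective ds ¬tx eq | yes tx | _     = contradiction tx ¬tx
    contract-injective ds ¬tx () | no  _  | yes _
    contract-injective ds ¬tx eq | no  _  | no  _ = Maybe.just-injective eq

    -- If the contracted trail is covered by z, then z covers one node of the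
    -- trail itself, and alternate links, starting from z, cover the others.
    uncontract : ∀ {x ds} → Trail x ds x → ∀ {zs} →
                 (∀ y → Any (λ z → contract ds y ≡ contract ds z) zs) →
                 ∃[ es ] (2 * length es ≤ length ds × (∀ y → Covers (zs ++ ends es) y))
    uncontract {ds = ds} t {zs} covered with Any.any? (touches? ds) zs
    ... | no ¬touched = [] , z≤n , λ y → Any.++⁺ˡ (cover y)
      where
      cover : ∀ y → Covers zs y
      cover y with z , z∈zs , eq ← find (covered y) =
        lose z∈zs (sym (contract-injective ds (λ tz → ¬touched (lose z∈zs tz)) (sym eq)))
    ... | yes touched
      with z , z∈zs , tz ← find touched
      with es , bound , cover ← closed-cover t tz
      = es , bound , λ y → coverᶻ y (touches? ds y)
      where
      coverᶻ : ∀ y → Dec (Touches ds y) → Covers (zs ++ ends es) y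
      coverᶻ y (no ¬ty) with w , w∈zs , eq ← find (covered y) =
        Any.++⁺ˡ (lose w∈zs (contract-injective ds ¬ty eq))
      coverᶻ y (yes ty) with d , d∈ds , y~d ← find ty | cover d∈ds
      ... | here d~z = Any.++⁺ˡ (lose z∈zs (trans y~d d~z))
      ... | there d~ = Any.++⁺ʳ zs (Any.map (trans y~d) d~)

-- Faces around a vertex and connectedness of the dual.

module Duality (G : Graph) (𝓔 : PlanarEmbedding G) where
  open Graph G
  open PlanarEmbedding 𝓔

  Face : Set
  Face = Fin faces

  side : Dart → Face
  side = face ∘ dart

  opposite-involutive : ∀ d → opposite (opposite d) ≡ d
  opposite-involutive (e , b) = cong (e ,_) (not-involutive b)

  face-next : ∀ x → face (next G clockwise x) ≡ face x
  face-next x = cong faceOfWalk (sym (Equivalence.from (Classes.exact walk) (1 , refl)))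

  -- The boundary walk that arrives along `opposite d` turns into `clockwise d` and keeps its face.
  -- So the darts around a vertex, in rotation order, form a trail in the dual.
  side-clockwise : ∀ d → side (clockwise d) ≡ side (opposite d)
  side-clockwise d = begin
    side (clockwise d)                        ≡⟨ cong (side ∘ clockwise) (opposite-involutive d) ⟨
    side (clockwise (opposite (opposite d)))  ≡⟨ face-next (dart (opposite d)) ⟩
    side (opposite d)                         ∎
    where open ≡-Reasoning

  base-clockwise : ∀ d → base (clockwise d) ≡ base d
  base-clockwise d = sym (Equivalence.to rotates (1 , refl))

  -- Connectedness of the dual, phrased for colourings because contraction is recorded by colours.
  -- Corners at one vertex agree since rotating past a dart crosses its edge; `joined` leads from
  -- vertex to vertex through common faces; and every face has a corner.
  dual-connected : (c : Face → A) → (∀ d → c (side d) ≡ c (side (opposite d))) →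
                   ∀ f g → c f ≡ c g
  dual-connected {A} c merged f g
    with w  , refl ← PlanarEmbedding.surjective 𝓔 f
    with w′ , refl ← PlanarEmbedding.surjective 𝓔 g
    with x  , refl ← Classes.surjective walk w
    with y  , refl ← Classes.surjective walk w′
    = along (joined (at G x) (at G y)) x y refl refl
    where
    rotate : ∀ d k → c (side d) ≡ c (side (fold d clockwise k))
    rotate d zero    = refl
    rotate d (suc k) = begin
      c (side d)                         ≡⟨ rotate d k ⟩
      c (side d′)                        ≡⟨ merged d′ ⟩
      c (side (opposite d′))             ≡⟨ cong c (side-clockwise d′) ⟨
      c (side (clockwise d′))            ∎
      where
      open ≡-Reasoning
      d′ = fold d clockwise k

    around : ∀ x y → at G x ≡ at G y → c (face x) ≡ c (face y)
    around (dart d) (dart d′) eq with k , refl ← Equivalence.from rotates eq = rotate d k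
    around (dart d) (isolated v i) eq = contradiction-irr i λ ¬i → ¬i (d , eq)
    around (isolated v i) (dart d) eq = contradiction-irr i λ ¬i → ¬i (d , sym eq)
    around (isolated v _) (isolated .v _) refl = refl

    along : ∀ {u v} → Star Cofacial u v → ∀ x y → at G x ≡ u → at G y ≡ v →
            c (face x) ≡ c (face y)
    along ε x y xu yu = around x y (trans xu (sym yu))
    along ((x′ , y′ , x′u , y′v , eq) ◅ path) x y xu yw = begin
      c (face x)   ≡⟨ around x x′ (trans xu (sym x′u)) ⟩
      c (face x′)  ≡⟨ cong c eq ⟩
      c (face y′)  ≡⟨ along path y′ y y′v yw ⟩
      c (face y)   ∎
      where open ≡-Reasoning

  open Trails side (side ∘ opposite) public

  -- The form that `perfectMatching` takes: in the dual graph `base` is `side`, so mapping `base`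
  -- over this list gives `ends ds`.
  bothDarts : List Dart → List Dart
  bothDarts = concatMap (λ d → d ∷ opposite d ∷ [])

  ends≡ : ∀ ds → ends ds ≡ map side (bothDarts ds)
  ends≡ ds = sym (map-concatMap side (λ d → d ∷ opposite d ∷ []) ds)

  opposite∈ : ∀ ds {d} → d ∈ bothDarts ds → opposite d ∈ bothDarts ds
  opposite∈ ds d∈ = ∈-concatMap⁺ _ (Any.map swap (∈-concatMap⁻ _ {xs = ds} d∈))
    where
    swap : ∀ {d d′} → d ∈ d′ ∷ opposite d′ ∷ [] → opposite d ∈ d′ ∷ opposite d′ ∷ []
    swap (here refl)         = there (here refl)
    swap (there (here refl)) = here (opposite-involutive _)

  -- Acyclic orientations: taking the vertices sinks first.

  module Oriented (o : Orientation G) where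
    open DecMembership (_≟_ {vertices}) using (_∈?_; _∉?_)

    -- A reverse topological order. The condition on edges rules out a loop at `v`, whose head would
    -- be outside `done`.
    data SinkFirst (done : List Vertex) : Set where
      finish : (∀ v → v ∈ done) → SinkFirst done
      remove : ∀ {v} → v ∉ done → (∀ {e} → tail G o e ≡ v → head G o e ∈ done) →
               SinkFirst (v ∷ done) → SinkFirst done

    -- On a finite set the iterates of `f` become periodic, and the edges between successive
    -- iterates over one least period have distinct tails. `P` is the invariant that provides the
    -- next edge.
    directedCycle : (P : Vertex → Set) (f : Vertex → Vertex) →
                    (∀ {v} → P v → P (f v) × ∃[ e ] (tail G o e ≡ v × head G o e ≡ f v)) →
                    ∀ {v} → P v → DirectedCycle G o
    directedCycle P f step {v} Pv
      with i , p ← eventuallyPeriodic f v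
      = record
        { k        = k
        ; arc      = arc ∘ toℕ
        ; distinct = λ {i} {j} eq →
            injective (trans (sym (tail-arc (toℕ i))) (trans eq (tail-arc (toℕ j))))
        ; closed   = closed
        }
      where
      open Period p
      a = fold v f i

      stays : ∀ {v} → P v → ∀ m → P (fold v f m)
      stays Pv zero    = Pv
      stays Pv (suc m) = proj₁ (step (stays Pv m))

      Pa : ∀ m → P (fold a f m)
      Pa = stays (stays Pv i)

      arc : ℕ → Edge
      arc m = proj₁ (proj₂ (step (Pa m)))

      tail-arc : ∀ m → tail G o (arc m) ≡ fold a f m
      tail-arc m = proj₁ (proj₂ (proj₂ (step (Pa m))))

      closed : ∀ j → head G o (arc (toℕ j)) ≡ tail G o (arc (toℕ (suc (toℕ j) mod suc k)))
      closed j = begin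
        head G o (arc (toℕ j))         ≡⟨ proj₂ (proj₂ (proj₂ (step (Pa (toℕ j))))) ⟩
        fold a f (suc (toℕ j))         ≡⟨ fold-% (suc (toℕ j)) ⟨
        fold a f (suc (toℕ j) % suc k)
          ≡⟨ cong (fold a f) (toℕ-fromℕ< (m%n<n (suc (toℕ j)) (suc k))) ⟨
        fold a f (toℕ j′)              ≡⟨ tail-arc (toℕ j′) ⟨
        tail G o (arc (toℕ j′))        ∎
        where
        open ≡-Reasoning
        j′ = suc (toℕ j) mod suc k

    -- Otherwise every vertex outside `done` has an edge leading to a vertex outside `done`, and
    -- following these edges yields a directed cycle.
    sink : Acyclic G o → ∀ {done u} → u ∉ done →
           ∃[ v ] (v ∉ done × (∀ {e} → tail G o e ≡ v → head G o e ∈ done))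
    sink acyclic {done} u∉done
      with any? (λ v → (v ∉? done) ×-dec
                       all? (λ e → (tail G o e ≟ v) →-dec (head G o e ∈? done)))
    ... | yes (v , v∉done , heads) = v , v∉done , λ {e} → heads e
    ... | no ¬sink = contradiction (directedCycle (_∉ done) next-vertex step u∉done) acyclic
      where
      escape? : ∀ v → Dec (∃[ e ] (tail G o e ≡ v × head G o e ∉ done))
      escape? v = any? (λ e → (tail G o e ≟ v) ×-dec (head G o e ∉? done))

      next-vertex : Vertex → Vertex
      next-vertex v with escape? v
      ... | yes (e , _) = head G o e
      -- A default value: `step` refutes this case for `v ∉ done`.
      ... | no  _       = v

      step : ∀ {v} → v ∉ done →
             next-vertex v ∉ done × ∃[ e ] (tail G o e ≡ v × head G o e ≡ next-vertex v)
      step {v} v∉done with escape? v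
      ... | yes (e , tail≡v , head∉done) = head∉done , e , tail≡v , refl
      ... | no  ¬escape = contradiction
        (v , v∉done , λ e tail≡v →
          decidable-stable (_ ∈? done) λ head∉done → ¬escape (e , tail≡v , head∉done))
        ¬sink

    remaining : List Vertex → List Vertex → ℕ
    remaining vs done = length (filter (_∉? done) vs)

    -- `n` bounds the number of vertices still to be taken and serves as the recursion measure.
    sinkFirst : Acyclic G o → ∀ n done → remaining (allFin vertices) done ≤ n → SinkFirst done
    sinkFirst acyclic n done bound with any? (_∉? done)
    sinkFirst acyclic n done bound | no all∈ =
      finish λ v → decidable-stable (v ∈? done) λ v∉ → all∈ (v , v∉)
    sinkFirst acyclic zero done bound | yes (u , u∉done) =
      contradiction (∈-length (∈-filter⁺ (_∉? done) (∈-allFin u) u∉done)) (≤⇒≯ bound)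
    sinkFirst acyclic (suc n) done bound | yes (u , u∉done)
      with v , v∉done , heads ← sink acyclic u∉done
      = remove v∉done heads (sinkFirst acyclic n (v ∷ done) (s≤s⁻¹ (≤-trans
          (+-monoˡ-≤ _ (∈-length (∈-filter⁺ (_≟ v) (∈-allFin v) refl)))
          (≤-trans (filter-∉-∷ _≟_ v∉done (allFin vertices)) bound))))

    -- The colouring c merges the two sides of every edge leaving v, so these
    -- edges can be dropped from the closed trail through all darts at v.
    inTrail : {A : Set} (_≟ᴬ_ : DecidableEquality A) (c : Face → A) → ∀ v →
              (∀ d → base d ≡ v → proj₂ d ≢ o (proj₁ d) → c (side d) ≡ c (side (opposite d))) →
              ∃[ f ] ∃[ ds ] (Trail _≟ᴬ_ c f ds f ×
                              (∀ {e} → head G o e ≡ v → (e , o e) ∈ ds) ×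
                              length ds ≤ indegree G o v)
    inTrail _≟ᴬ_ c v merged with any? (λ e → head G o e ≟ v)
    ... | no  none =
      -- Without incoming edges the trail is empty and may sit at any face; `cornerAt` supplies one.
      face (cornerAt G v) , [] , stop refl , (λ eq → contradiction (_ , eq) none) , z≤n
    ... | yes (e₀ , refl) =
      side d₀ , filter in? orbit , trail-filter _≟ᴬ_ c in? skip orbitTrail , ins∈ , bound
      where
      d₀ : Dart
      d₀ = e₀ , o e₀

      _≟ᴰ_ : DecidableEquality Dart
      _≟ᴰ_ = Product.≡-dec _≟_ Bool._≟_

      p : Period clockwise d₀
      -- Rotation is transitive on the darts at a vertex, so some `m` steps lead from `clockwise d₀`
      -- back to `d₀`.
      p with m , eq ← Equivalence.from rotates (base-clockwise d₀) =
        period _≟ᴰ_ clockwise d₀ {m} (begin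
          fold d₀ clockwise (suc m)        ≡⟨ cong (fold d₀ clockwise) (+-comm m 1) ⟨
          fold d₀ clockwise (m + 1)        ≡⟨ fold-+ d₀ clockwise m ⟩
          fold (clockwise d₀) clockwise m  ≡⟨ eq ⟩
          d₀                               ∎)
        where open ≡-Reasoning

      open Period p

      orbit : List Dart
      orbit = applyUpTo (fold d₀ clockwise) (suc k)

      ∈-orbit : ∀ {d} → base d ≡ base d₀ → d ∈ orbit
      ∈-orbit eq with m , refl ← Equivalence.from rotates (sym eq) =
        subst (_∈ orbit) (fold-% m) (∈-applyUpTo⁺ (fold d₀ clockwise) (m%n<n m (suc k)))

      base-orbit : ∀ {d} → d ∈ orbit → base d ≡ base d₀
      base-orbit d∈ with m , _ , refl ← ∈-applyUpTo⁻ (fold d₀ clockwise) d∈ =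
        sym (Equivalence.to rotates (m , refl))

      orbitTrail : Trail _≟ᴬ_ c (side d₀) orbit (side d₀)
      orbitTrail = subst (λ d → Trail _≟ᴬ_ c (side d₀) orbit (side d)) returns
        (go (fold d₀ clockwise) (λ _ → refl) (suc k))
        where
        -- Stated for a sequence `f` because `applyUpTo` recurses on `f ∘ suc`.
        go : (f : ℕ → Dart) → (∀ m → f (suc m) ≡ clockwise (f m)) → ∀ m →
             Trail _≟ᴬ_ c (side (f 0)) (applyUpTo f m) (side (f m))
        go f f-suc zero    = stop refl
        go f f-suc (suc m) = refl ∷
          recolour _≟ᴬ_ c
            (cong c (trans (sym (side-clockwise (f 0))) (cong side (sym (f-suc 0)))))
            (go (f ∘ suc) (f-suc ∘ suc) m)

      in? : Decidable (λ (d : Dart) → proj₂ d ≡ o (proj₁ d))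
      in? d = proj₂ d Bool.≟ o (proj₁ d)

      skip : ∀ {d} → d ∈ orbit → proj₂ d ≢ o (proj₁ d) → c (side d) ≡ c (side (opposite d))
      skip d∈ = merged _ (base-orbit d∈)

      ins∈ : ∀ {e} → head G o e ≡ base d₀ → (e , o e) ∈ filter in? orbit
      ins∈ eq = ∈-filter⁺ in? (∈-orbit eq) refl

      inEdges : List Edge
      inEdges = filter (λ e → head G o e ≟ base d₀) (allFin edges)

      -- Each incoming edge is counted once: of the two darts of a loop at the vertex, only the one
      -- at the head passes `in?`.
      ins⊆ : filter in? orbit ⊆ map (λ e → e , o e) inEdges
      ins⊆ {e , b} d∈ with d∈orbit , refl ← ∈-filter⁻ in? {xs = orbit} d∈ =
        ∈-map⁺ _ (∈-filter⁺ (λ e → head G o e ≟ base d₀) (∈-allFin e) (base-orbit d∈orbit))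

      bound : length (filter in? orbit) ≤ length inEdges
      bound = ≤-trans
        (unique-⊆⇒length≤ _≟ᴰ_
          (Unique.filter⁺ in? (Unique.applyUpTo⁺₁ (fold d₀ clockwise) (suc k) separates)) ins⊆)
        (≤-reflexive (length-map _ inEdges))

    -- Counting the matching edges.

    module _ (s : Vertex) (odd : ∀ v → v ≢ s → 2 ∤ indegree G o v) where

      -- Multiplicities are indegrees, except that the extra entry gives `s` one more. This list is
      -- the budget of the count in `cover`.
      heads : List Vertex
      heads = s ∷ map (head G o) (allFin edges)

      -- For `v ≢ s` the even number `2 * n` cannot equal an odd indegree, so it is smaller; for `s`
      -- the extra entry supplies the strictness.
      odd-bound : ∀ v n → 2 * n ≤ indegree G o v → suc (2 * n) ≤ length (filter (_≟ v) heads)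
      odd-bound v n bound with s ≟ v
      ... | yes refl = s≤s
        (subst (2 * n ≤_) (sym (length-filter-map (_≟ v) _ (allFin edges))) bound)
      ... | no  s≢v  = subst (2 * n <_) (sym (length-filter-map (_≟ v) _ (allFin edges)))
        (≤∧≢⇒< bound λ eq → odd v (s≢v ∘ sym) (divides n (trans (sym eq) (*-comm 2 n))))

      -- An edge into `v` is a link of the trail, so both its sides lie on the trail and become one
      -- node; faces merged earlier stay merged. This carries the invariant of `cover` on to
      -- `v ∷ done`.
      contract-merged : {A : Set} (_≟ᴬ_ : DecidableEquality A) (c : Face → A) → ∀ {done v x es} →
        (∀ d → head G o (proj₁ d) ∈ done → c (side d) ≡ c (side (opposite d))) →
        Trail _≟ᴬ_ c x es x → (∀ {e} → head G o e ≡ v → (e , o e) ∈ es) →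
        ∀ d → head G o (proj₁ d) ∈ v ∷ done →
        contract _≟ᴬ_ c es (side d) ≡ contract _≟ᴬ_ c es (side (opposite d))
      contract-merged _≟ᴬ_ c {es = es} merged t ins d       (there h∈)  =
        contract-cong _≟ᴬ_ c es (merged d h∈)
      contract-merged _≟ᴬ_ c {es = es} merged t ins (e , b) (here h≡v) =
        contract-touched _≟ᴬ_ c es (touched b) (touched (not b))
        where
        touched : ∀ b → Touches _≟ᴬ_ c es (side (e , b))
        touched b with b Bool.≟ o e
        ... | yes refl = lose (ins h≡v) refl
        ... | no  b≢o  = subst (λ b → Touches _≟ᴬ_ c es (side (e , b))) (sym (¬-not b≢o))
                           (hi-touched _≟ᴬ_ c t (ins h≡v))

      regroup : ∀ a b c → 2 * (a + b) + c ≡ 2 * b + (2 * a + c)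
      regroup = solve-∀

      move-suc : ∀ a b c → a + (suc b + c) ≡ b + (suc a + c)
      move-suc = solve-∀

      -- `A` is quantified because each contraction passes to colours in `Maybe A`. In the bound,
      -- `remaining heads done` is the budget left. Undoing the contraction at `v` lowers
      -- `length done` by one and adds the edges `ns`; the `suc (2 * length ns)` needed for both is
      -- found among the entries `v` of `heads`.
      cover : ∀ {done} → SinkFirst done → {A : Set} (_≟ᴬ_ : DecidableEquality A) (c : Face → A) →
              (∀ d → head G o (proj₁ d) ∈ done → c (side d) ≡ c (side (opposite d))) →
              ∀ f → ∃[ ds ] ((∀ g → Any (λ z → c g ≡ c z) (f ∷ ends ds)) ×
                             2 * length ds + vertices ≤ length done + remaining heads done)
      cover {done} (finish all∈) _≟ᴬ_ c merged f =
        [] ,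
        -- Every edge has its head in `done`, so colours agree across all edges and the connected
        -- dual has shrunk to one node, which `f` covers.
        (λ g → here (dual-connected c (λ d → merged d (all∈ _)) g f)) ,
        ≤-trans (≤-reflexive (sym (length-tabulate id)))
          (≤-trans (unique-⊆⇒length≤ _≟_ (Unique.allFin⁺ vertices) (λ {v} _ → all∈ v))
                   (m≤m+n (length done) _))
      cover {done} (remove {v} v∉done out rest) _≟ᴬ_ c merged f
        with x , es , t , ins , ∣es∣≤ ← inTrail _≟ᴬ_ c v
               -- A dart at `v` that is not at the head of its edge is at the tail; the edge then
               -- leads into `done` and its sides are merged already.
               (λ { d refl ≢o → merged d (out (cong (end (proj₁ d)) (sym (¬-not ≢o)))) })
        with ds , covered , ih ← cover rest (Maybe.≡-dec _≟ᴬ_) (contract _≟ᴬ_ c es)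
               (contract-merged _≟ᴬ_ c merged t ins) f
        with ns , ∣ns∣≤ , covers ← uncontract _≟ᴬ_ c t covered
        = ds ++ ns ,
          (λ g → subst (Any _) (cong (f ∷_) (sym (concatMap-++ _ ds ns))) (covers g)) ,
          (begin
            2 * length (ds ++ ns) + vertices
              ≡⟨ cong (λ l → 2 * l + vertices) (length-++ ds) ⟩
            2 * (length ds + length ns) + vertices
              ≡⟨ regroup (length ds) (length ns) vertices ⟩
            2 * length ns + (2 * length ds + vertices)
              ≤⟨ +-monoʳ-≤ (2 * length ns) ih ⟩
            2 * length ns + (suc (length done) + remaining heads (v ∷ done))
              ≡⟨ move-suc (2 * length ns) (length done) _ ⟩
            length done + (suc (2 * length ns) + remaining heads (v ∷ done))
              ≤⟨ +-monoʳ-≤ (length done)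
                   (+-monoˡ-≤ _ (odd-bound v (length ns) (≤-trans ∣ns∣≤ ∣es∣≤))) ⟩
            length done + (length (filter (_≟ v) heads) + remaining heads (v ∷ done))
              ≤⟨ +-monoʳ-≤ (length done) (filter-∉-∷ _≟_ v∉done heads) ⟩
            length done + remaining heads done ∎)
        where open ≤-Reasoning

      -- Covering takes at least `faces` entries, so the bound forces equality and lets
      -- `tight⇒unique` exclude repetitions. The count starts with nothing contracted and with all
      -- `suc edges` entries of `heads` as budget.
      cover-all : Acyclic G o → ∀ f →
                  ∃[ ds ] ((∀ g → g ∈ f ∷ ends ds) × length (f ∷ ends ds) ≤ faces)
      cover-all acyclic f
        with ds , covered , bound ← cover (sinkFirst acyclic _ [] ≤-refl) _≟_ id (λ _ ()) f
        = ds , covered , +-cancelˡ-≤ vertices _ _ (begin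
          vertices + suc (length (ends ds))
            ≡⟨ cong (λ l → vertices + suc l) (length-ends ds) ⟩
          vertices + suc (2 * length ds)
            ≡⟨ rearrange vertices (2 * length ds) ⟩
          suc (2 * length ds + vertices)
            ≤⟨ s≤s (≤-trans bound (length-filter (_∉? []) heads)) ⟩
          suc (length heads)
            ≡⟨ cong (2 +_) (trans (length-map _ (allFin edges)) (length-tabulate id)) ⟩
          2 + edges
            ≤⟨ +-cancelˡ-≤ components _ _ euler-bound ⟩
          vertices + faces ∎)
        where
        open ≤-Reasoning
        rearrange : ∀ a b → a + suc b ≡ suc (b + a)
        rearrange = solve-∀
        regroup² : ∀ a b → a + (a + b) ≡ b + 2 * a
        regroup² = solve-∀
        swap-+ : ∀ a b c → a + (b + c) ≡ b + (a + c)
        swap-+ = solve-∀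

        -- `euler` and `tree` add up to V + F = E + C + 1, and C ≥ 1 since `s` lies in a component.
        -- `components` stands on both sides to avoid subtraction.
        euler-bound : components + (2 + edges) ≤ components + (vertices + faces)
        euler-bound = begin
          components + (2 + edges)           ≡⟨ swap-+ components 2 edges ⟩
          2 + (components + edges)           ≤⟨ s≤s (+-monoˡ-≤ _ 1≤components) ⟩
          suc (components + (components + edges)) ≡⟨ cong suc (regroup² components edges) ⟩
          suc (edges + 2 * components)       ≡⟨ cong suc euler ⟨
          suc (vertices + walks)             ≡⟨ +-suc vertices walks ⟨
          vertices + suc walks               ≡⟨ cong (vertices +_) tree ⟨
          vertices + (components + faces)    ≡⟨ swap-+ vertices components faces ⟩
          components + (vertices + faces)    ∎
          where
          1≤components : 1 ≤ components
          1≤components = >-nonZero⁻¹ components ⦃ nonZeroIndex (Classes.class component s) ⦄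

-- From a repetition-free cover to a perfect matching.

unique-map⇒injective : (f : A → B) {xs : List A} → Unique (map f xs) →
                       ∀ {x y} → x ∈ xs → y ∈ xs → f x ≡ f y → x ≡ y
unique-map⇒injective f (_ ∷ _)   (here refl) (here refl) eq = refl
unique-map⇒injective f (∉xs ∷ _) (here refl) (there y∈)  eq =
  contradiction eq (All.lookup ∉xs (∈-map⁺ f y∈))
unique-map⇒injective f (∉xs ∷ _) (there x∈)  (here refl) eq =
  contradiction (sym eq) (All.lookup ∉xs (∈-map⁺ f x∈))
unique-map⇒injective f (_ ∷ xs!) (there x∈)  (there y∈)  eq = unique-map⇒injective f xs! x∈ y∈ eq

x∉p-x : ∀ (p : Subset n) x → ¬ (x ∈ˢ p - x)
x∉p-x (_ ∷ p) (suc x) (there x∈) = x∉p-x p x x∈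

module _ (H : Graph) where
  open Graph H

  -- `ds` holds both darts of each chosen edge. As `base` is injective on `ds`, no chosen edge is a
  -- loop and no two share an end; as `v` is not among the bases, all avoid `v`.
  perfectMatching : ∀ {v} (ds : List Dart) → (∀ {d} → d ∈ ds → opposite d ∈ ds) →
                    (∀ u → u ∈ v ∷ map base ds) → Unique (v ∷ map base ds) →
                    PerfectMatching H (⊤ - v)
  perfectMatching {v} ds symmetric covered (v∉ ∷ ends!) = record
    { matching = matching
    ; within   = λ e∈ b → x∈p∧x≢y⇒x∈p-y ∈⊤ (All.lookup v∉ (∈-map⁺ base (∈-matching⁻ e∈ b)) ∘ sym)
    ; loopless = λ e∈ eq →
        false≢true (cong proj₂ (dart≡ (∈-matching⁻ e∈ false) (∈-matching⁻ e∈ true) eq))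
    ; covers   = covers
    }
    where
    open DecMembership (Product.≡-dec (_≟_ {edges}) Bool._≟_) using (_∈?_)

    false≢true : false ≢ true
    false≢true ()

    dart≡ : ∀ {d d′} → d ∈ ds → d′ ∈ ds → base d ≡ base d′ → d ≡ d′
    dart≡ = unique-map⇒injective base ends!

    -- Testing one dart of each edge suffices by `symmetric`.
    matching : Subset edges
    matching = tabulate (λ e → does ((e , false) ∈? ds))

    lookup-matching : ∀ e → Vec.lookup matching e ≡ does ((e , false) ∈? ds)
    lookup-matching = lookup∘tabulate (λ e → does ((e , false) ∈? ds))

    ∈-matching⁻ : ∀ {e} → e ∈ˢ matching → ∀ b → (e , b) ∈ ds
    ∈-matching⁻ {e} e∈ b with (e , false) ∈? ds | trans (sym (lookup-matching e)) ([]=⇒lookup e∈)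
    ∈-matching⁻ e∈ false | yes e∈ds | _ = e∈ds
    ∈-matching⁻ e∈ true  | yes e∈ds | _ = symmetric e∈ds
    ∈-matching⁻ e∈ b     | no  _    | ()

    ∈-matching⁺ : ∀ {e b} → (e , b) ∈ ds → e ∈ˢ matching
    ∈-matching⁺ {e} {false} e∈ds =
      lookup⇒[]= e matching (trans (lookup-matching e) (dec-true ((e , false) ∈? ds) e∈ds))
    ∈-matching⁺ {e} {true}  e∈ds = ∈-matching⁺ (symmetric e∈ds)

    covers : ∀ {u} → u ∈ˢ ⊤ - v → ∃! _≡_ (λ e → e ∈ˢ matching × Incident e u)
    covers {u} u∈ with covered u
    ... | here refl = contradiction u∈ (x∉p-x ⊤ u)
    ... | there u∈ends with (e , b) , e∈ds , refl ← ∈-map⁻ base u∈ends =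
      e , (∈-matching⁺ e∈ds , b , refl) , λ (e′∈ , b′ , eq) →
        cong proj₁ (dart≡ e∈ds (∈-matching⁻ e′∈ b′) (sym eq))

theorem14 : (G : Graph) → DualCritical G →
    (𝓔 : PlanarEmbedding G) → FactorCritical (dual G 𝓔)
theorem14 G (o , acyclic , s , _ , odd) 𝓔 f
  with ds , covered , bound ← Duality.Oriented.cover-all G 𝓔 o s odd acyclic f
  = perfectMatching (dual G 𝓔) (bothDarts ds) (opposite∈ ds)
      (λ g → subst (λ gs → g ∈ f ∷ gs) (ends≡ ds) (covered g))
      (subst (λ gs → Unique (f ∷ gs)) (ends≡ ds)
        (tight⇒unique _≟_ (Unique.allFin⁺ _) (λ {g} _ → covered g)
          (≤-trans bound (≤-reflexive (sym (length-tabulate id))))))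
  where open Duality G 𝓔
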